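{- For an integer $m\ge0$ let $\mathbf{S}_m=\{1,\dots,m\}^2$, and let $B_{\mathbf{S}}(m,k)$ be the number of $k$-element subsets of $\mathbf{S}_m$ no two distinct elements $(i,j),(i',j')$ of which satisfy $i-j=i'-j'$ or $i+j=i'+j'$ (nonattacking placements of $k$ bishops). Then for all integers $m,k\ge 0$, $$B_{\mathbf{S}}(m,k)=\sum_{j=0}^{k}\sum_{i=0}^{j}\binom{\lfloor m/2\rfloor}{i}\left\{ {m-i \atop m-j}\right\}\sum_{l=0}^{k-j}\binom{\lceil m/2\rceil}{l}\left\{ {m-l \atop m-k+j}\right\}.$$
   Context: The Stirling numbers of the second kind $\left\{ {n \atop r}\right\}$ are used in the extended sense for all integers $n,r$: for $n,r\ge0$ they are the usual ones; for $n,r\le 0$, $\left\{ {n \atop r}\right\}=\left[{ -r \atop -n}\right]$, the unsigned Stirling number of the first kind; and they are $0$ when one of $n,r$ is positive and the other negative (Knuth's extension, satisfying $\left\{ {n \atop r}\right\}=r\left\{ {n-1 \atop r}\right\}+\left\{ {n-1 \atop r-1}\right\}$ for all integers). -}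

module Defs where

open import Data.Fin.Base using (Fin; toℕ; remQuot)
open import Data.Fin.Properties using (all?) renaming (_≟_ to _≟ᶠ_)
open import Data.Fin.Subset using (Subset; inside; outside; _∈_; ∣_∣)
open import Data.Fin.Subset.Properties using (_∈?_)
open import Data.Integer.Base as ℤ using (ℤ; +_; -[1+_])
import Data.Integer.Properties as ℤ
open import Data.List.Base using (List; [_]; _++_; map; filter; length; upTo)
open import Data.Nat.Base using (ℕ; zero; suc; _+_; _*_)
open import Data.Nat.ListAction using (sum)
open import Data.Nat.Properties using (_≟_)
open import Data.Product.Base using (proj₁; proj₂)
open import Data.Sum.Base using (_⊎_)
import Data.Vec.Base as Vec
open import Relation.Binary.PropositionalEquality.Core using (_≡_; _≢_)
open import Relation.Nullary.Decidable.Core using (Dec; _×-dec_; _⊎-dec_; _→-dec_; ¬?)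
open import Relation.Nullary.Negation.Core using (¬_)

-- Both endpoints are included: ∑₀ n f = f 0 + ⋯ + f n.
∑₀ : ℕ → (ℕ → ℕ) → ℕ
∑₀ n f = sum (map f (upTo (suc n)))

syntax ∑₀ n (λ i → e) = ∑[ i ≤ n ] e

infixr 5 ∑₀

-- Stirling numbers: S₁ n r is [n r] (first kind, unsigned), S₂ n r is {n r}
-- (second kind).
S₁ : ℕ → ℕ → ℕ
S₁ zero    zero    = 1
S₁ zero    (suc r) = 0
S₁ (suc n) zero    = 0
S₁ (suc n) (suc r) = n * S₁ n (suc r) + S₁ n r

S₂ : ℕ → ℕ → ℕ
S₂ zero    zero    = 1
S₂ zero    (suc r) = 0
S₂ (suc n) zero    = 0
S₂ (suc n) (suc r) = suc r * S₂ n (suc r) + S₂ n r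

-- Knuth's extension {n r} = [-r -n] of the second kind to all integers.  The
-- two sign quadrants overlap only at (0 , 0), where S₂ 0 0 = S₁ 0 0 = 1.
stirling : ℤ → ℤ → ℕ
stirling (+ n)     (+ r)     = S₂ n r
stirling -[1+ n ]  -[1+ r ]  = S₁ (suc r) (suc n)
stirling (+ zero)  -[1+ r ]  = S₁ (suc r) 0
stirling -[1+ n ]  (+ zero)  = S₁ 0 (suc n)
stirling (+ suc n) -[1+ r ]  = 0
stirling -[1+ n ]  (+ suc r) = 0

-- The m × m board is Fin (m * m), identified with {1,…,m}² by the bijection
-- remQuot together with the shift Fin m ≅ {1,…,m}.
Square : ℕ → Set
Square m = Fin (m * m)

row col : ∀ {m} → Square m → ℤ
row {m} s = + suc (toℕ (proj₁ (remQuot {m} m s)))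
col {m} s = + suc (toℕ (proj₂ (remQuot {m} m s)))

SameDiagonal : ∀ {m} → Square m → Square m → Set
SameDiagonal {m} s t =
  (row {m} s ℤ.- col {m} s ≡ row {m} t ℤ.- col {m} t) ⊎
  (row {m} s ℤ.+ col {m} s ≡ row {m} t ℤ.+ col {m} t)

Nonattacking : ∀ {m} → Subset (m * m) → Set
Nonattacking {m} p =
  (s t : Square m) → s ∈ p → t ∈ p → s ≢ t → ¬ SameDiagonal {m} s t

sameDiagonal? : ∀ {m} (s t : Square m) → Dec (SameDiagonal {m} s t)
sameDiagonal? {m} s t =
  (row {m} s ℤ.- col {m} s ℤ.≟ row {m} t ℤ.- col {m} t) ⊎-dec
  (row {m} s ℤ.+ col {m} s ℤ.≟ row {m} t ℤ.+ col {m} t)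

nonattacking? : ∀ {m} (p : Subset (m * m)) → Dec (Nonattacking {m} p)
nonattacking? {m} p = all? λ s → all? λ t →
  (s ∈? p) →-dec ((t ∈? p) →-dec
    (¬? (s ≟ᶠ t) →-dec ¬? (sameDiagonal? {m} s t)))

-- Every subset of Fin n, listed exactly once.
subsets : ∀ n → List (Subset n)
subsets zero    = [ Vec.[] ]
subsets (suc n) =
  map (inside Vec.∷_) (subsets n) ++ map (outside Vec.∷_) (subsets n)

-- The number of placements of k nonattacking bishops on the m × m board.
B : ℕ → ℕ → ℕ
B m k =
  length (filter (λ p → (∣ p ∣ ≟ k) ×-dec nonattacking? {m} p) (subsets (m * m)))

{-# OPTIONS --safe #-}
module Submission where

-- In the coordinates d = i − j and s = i + j, bishops are rooks, and the two
-- colours of the board do not interact, so the count is a convolution over the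
-- colours.  Sort the diagonals of one colour by length (adding one empty
-- diagonal to the colour whose lengths are even): the c-th of them (c = 0, …, m − 1)
-- has length c or c + 1, alternately, and the antidiagonals it meets include
-- those met by all shorter ones.  Hence each colour is a Ferrers board,
-- namely the staircase 0, 1, …, m − 1, whose rook numbers are Stirling numbers
-- {m m−t}, with one extra cell on ⌊m/2⌋ or ⌈m/2⌉ of its columns.  The extra
-- cells do not attack each other, and a rook on one of them deletes a row and
-- a column and leaves a staircase; choosing i extra cells to be occupied gives
-- the sum of (h choose i) {m−i m−j}.

open import Defs
open import Data.Bool.Base using (Bool; true; false; not; _∧_; if_then_else_)
open import Data.Bool.Properties using (∧-assoc; ∧-comm; ∧-identityʳ; ∧-zeroʳ)
open import Data.Empty using (⊥-elim)
open import Data.Fin.Base using (Fin; zero; suc; toℕ; fromℕ<; remQuot; combine)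
open import Data.Fin.Properties using (toℕ<n; toℕ-fromℕ<; toℕ-injective; remQuot-combine; combine-remQuot) renaming (suc-injective to Fin-suc-injective)
open import Data.Fin.Subset as Subset using (Subset; inside; outside; ∣_∣)
open import Data.Integer.Base using (+_; -[1+_]; _⊖_) renaming (_+_ to _+ℤ_; _-_ to _-ℤ_)
import Data.Integer.Properties as ℤ
open import Algebra.Properties.AbelianGroup ℤ.+-0-abelianGroup using () renaming (∙-cancelʳ to +ℤ-cancelʳ)
open import Data.List.Base using (List; []; _∷_; _++_; map; length; filter; tabulate; applyUpTo)
open import Data.List.Membership.Propositional using (_∈_)
open import Data.List.Membership.Propositional.Properties using (∈-map⁺; ∈-map⁻; ∈-++⁺ˡ; ∈-++⁺ʳ; ∈-++⁻; ∈-applyUpTo⁺; ∈-applyUpTo⁻; ∈-tabulate⁺; ∈-tabulate⁻)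
open import Data.List.Membership.Propositional.Properties.WithK using (unique∧set⇒bag)
open import Data.List.Properties using (filter-++; filter-none; length-++; length-applyUpTo; map-upTo)
open import Data.List.Relation.Binary.BagAndSetEquality using (∼bag⇒↭)
open import Data.List.Relation.Binary.Permutation.Propositional as Perm using (_↭_)
import Data.List.Relation.Unary.All as All
open import Data.List.Relation.Unary.AllPairs using ([]; _∷_)
open import Data.List.Relation.Unary.Any using (here; there)
open import Data.List.Relation.Unary.Unique.Propositional using (Unique)
import Data.List.Relation.Unary.Unique.Propositional.Properties as Unique
open import Data.Nat.Base using (ℕ; zero; suc; _+_; _*_; _∸_; _≤_; _<_; z≤n; s≤s; s≤s⁻¹; ⌊_/2⌋; ⌈_/2⌉)
open import Data.Nat.Combinatorics using (_C_; k>n⇒nCk≡0; nCk+nC[k+1]≡[n+1]C[k+1])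
open import Data.Nat.ListAction using (sum)
open import Data.Nat.Properties renaming (suc-injective to ℕ-suc-injective)
open import Data.Nat.Solver using (module +-*-Solver)
open import Data.Product.Base using (_,_; _×_; proj₁; proj₂; ∃; ∃₂)
open import Data.Sum.Base using (_⊎_; inj₁; inj₂; [_,_]′)
open import Data.Vec.Base using ([]; _∷_; here; there)
open import Function.Base using (_∘_; const)
open import Function.Bundles using (_⇔_; mk⇔; module Equivalence)
open import Relation.Binary.PropositionalEquality using (_≡_; _≢_; refl; sym; trans; cong; cong₂; subst; module ≡-Reasoning)
open import Relation.Nullary.Decidable using (Dec; yes; no; does; dec-true; dec-false; does-⇔; _×-dec_; ¬?)
open import Relation.Nullary.Negation.Core using (¬_)
open import Relation.Unary using (Decidable)

open +-*-Solver using (solve; _:+_; _:*_; _:=_; con)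
open Equivalence using (to; from)

-- Finite sums.

∑₀-suc : ∀ n (f : ℕ → ℕ) → ∑₀ (suc n) f ≡ f 0 + ∑₀ n (f ∘ suc)
∑₀-suc n f = cong sum (trans (map-upTo f (suc (suc n)))
  (sym (cong (f 0 ∷_) (map-upTo (f ∘ suc) (suc n)))))

∑₀-cong : ∀ n {f g : ℕ → ℕ} → (∀ i → i ≤ n → f i ≡ g i) → ∑₀ n f ≡ ∑₀ n g
∑₀-cong zero    f≡g = cong (_+ 0) (f≡g 0 z≤n)
∑₀-cong (suc n) {f} {g} f≡g = begin
  ∑₀ (suc n) f           ≡⟨ ∑₀-suc n f ⟩
  f 0 + ∑₀ n (f ∘ suc)   ≡⟨ cong₂ _+_ (f≡g 0 z≤n) (∑₀-cong n λ i i≤n → f≡g (suc i) (s≤s i≤n)) ⟩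
  g 0 + ∑₀ n (g ∘ suc)   ≡⟨ ∑₀-suc n g ⟨
  ∑₀ (suc n) g           ∎
  where open ≡-Reasoning

∑₀-+ : ∀ n (f g : ℕ → ℕ) → ∑₀ n (λ i → f i + g i) ≡ ∑₀ n f + ∑₀ n g
∑₀-+ zero    f g = solve 2 (λ a b → a :+ b :+ con 0 := (a :+ con 0) :+ (b :+ con 0)) refl (f 0) (g 0)
∑₀-+ (suc n) f g = begin
  ∑₀ (suc n) (λ i → f i + g i)
    ≡⟨ ∑₀-suc n (λ i → f i + g i) ⟩
  f 0 + g 0 + ∑₀ n (λ i → f (suc i) + g (suc i))
    ≡⟨ cong (_+_ (f 0 + g 0)) (∑₀-+ n (f ∘ suc) (g ∘ suc)) ⟩
  f 0 + g 0 + (∑₀ n (f ∘ suc) + ∑₀ n (g ∘ suc))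
    ≡⟨ solve 4 (λ a b c d → a :+ b :+ (c :+ d) := (a :+ c) :+ (b :+ d)) refl (f 0) (g 0) _ _ ⟩
  (f 0 + ∑₀ n (f ∘ suc)) + (g 0 + ∑₀ n (g ∘ suc))
    ≡⟨ cong₂ _+_ (∑₀-suc n f) (∑₀-suc n g) ⟨
  ∑₀ (suc n) f + ∑₀ (suc n) g ∎
  where open ≡-Reasoning

∑₀-*ʳ : ∀ n (f : ℕ → ℕ) x → ∑₀ n (λ i → f i * x) ≡ ∑₀ n f * x
∑₀-*ʳ zero    f x = solve 2 (λ a b → a :* b :+ con 0 := (a :+ con 0) :* b) refl (f 0) x
∑₀-*ʳ (suc n) f x = begin
  ∑₀ (suc n) (λ i → f i * x)            ≡⟨ ∑₀-suc n (λ i → f i * x) ⟩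
  f 0 * x + ∑₀ n (λ i → f (suc i) * x)  ≡⟨ cong (_+_ (f 0 * x)) (∑₀-*ʳ n (f ∘ suc) x) ⟩
  f 0 * x + ∑₀ n (f ∘ suc) * x          ≡⟨ *-distribʳ-+ x (f 0) _ ⟨
  (f 0 + ∑₀ n (f ∘ suc)) * x            ≡⟨ cong (_* x) (∑₀-suc n f) ⟨
  ∑₀ (suc n) f * x                      ∎
  where open ≡-Reasoning

∑₀-vanish : ∀ n {f : ℕ → ℕ} → (∀ i → f i ≡ 0) → ∑₀ n f ≡ 0
∑₀-vanish zero    f≡0 = cong (_+ 0) (f≡0 0)
∑₀-vanish (suc n) {f} f≡0 = trans (∑₀-suc n f) (cong₂ _+_ (f≡0 0) (∑₀-vanish n (f≡0 ∘ suc)))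

-- Staircase boards and Stirling numbers.

-- Placements of t rooks on the staircase board with columns of heights
-- 0, 1, …, n − 1.
staircase : ℕ → ℕ → ℕ
staircase n       zero    = 1
staircase zero    (suc t) = 0
staircase (suc n) (suc t) = staircase n (suc t) + (n ∸ t) * staircase n t

staircase-zero : ∀ {n t} → n < t → staircase n t ≡ 0
staircase-zero {zero}  {suc t} _         = refl
staircase-zero {suc n} {suc t} (s≤s n<t)
  rewrite staircase-zero {n} {suc t} (m<n⇒m<1+n n<t) | staircase-zero n<t = *-zeroʳ (n ∸ t)

S₂-diagonal : ∀ n → S₂ n n ≡ 1
S₂-above : ∀ {n r} → n < r → S₂ n r ≡ 0
S₂-diagonal zero    = refl
S₂-diagonal (suc n) rewrite S₂-above (n<1+n n) | S₂-diagonal n = cong (_+ 1) (*-zeroʳ (suc n))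
S₂-above {zero}  {suc r} _         = refl
S₂-above {suc n} {suc r} (s≤s n<r)
  rewrite S₂-above {n} {suc r} (m<n⇒m<1+n n<r) | S₂-above n<r = cong (_+ 0) (*-zeroʳ (suc r))

-- Both sides obey one recursion: the factor r in the Stirling recurrence counts the rows of the
-- last column, of height r + t - 1, left free by t - 1 rooks in earlier columns.
S₂-staircase : ∀ r t → S₂ (r + t) r ≡ staircase (r + t) t
S₂-staircase r zero rewrite +-identityʳ r = S₂-diagonal r
S₂-staircase zero (suc t)
  rewrite n∸n≡0 t | staircase-zero (n<1+n t) = refl
S₂-staircase (suc r) (suc t) = begin
  suc r * S₂ (r + suc t) (suc r) + S₂ (r + suc t) r
    ≡⟨ cong₂ _+_ (cong (λ n → suc r * S₂ n (suc r)) (+-suc r t)) (S₂-staircase r (suc t)) ⟩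
  suc r * S₂ (suc r + t) (suc r) + staircase (r + suc t) (suc t)
    ≡⟨ cong (λ s → suc r * s + staircase (r + suc t) (suc t)) (S₂-staircase (suc r) t) ⟩
  suc r * staircase (suc r + t) t + staircase (r + suc t) (suc t)
    ≡⟨ +-comm (suc r * staircase (suc r + t) t) _ ⟩
  staircase (r + suc t) (suc t) + suc r * staircase (suc r + t) t
    ≡⟨ cong (_+_ (staircase (r + suc t) (suc t))) (cong₂ _*_
        (trans (cong (_∸ t) (+-suc r t)) (m+n∸n≡m (suc r) t))
        (cong (λ n → staircase n t) (+-suc r t))) ⟨
  staircase (r + suc t) (suc t) + (r + suc t ∸ t) * staircase (r + suc t) t ∎
  where open ≡-Reasoning

stirling-negative : ∀ n r → stirling (+ n) -[1+ r ] ≡ 0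
stirling-negative zero    r = refl
stirling-negative (suc n) r = refl

m-n≡m∸n : ∀ {m n} → n ≤ m → + m -ℤ + n ≡ + (m ∸ n)
m-n≡m∸n {m} {n} n≤m = trans (ℤ.m-n≡m⊖n m n) (ℤ.⊖-≥ n≤m)

-- For t > n the lower index is negative, and Knuth's extension is 0 there since n ≥ 0; likewise
-- more rooks than columns cannot be placed.
stirling-staircase : ∀ n t → stirling (+ n) (+ n -ℤ + t) ≡ staircase n t
stirling-staircase n t with t ≤? n
... | yes t≤n = trans (cong (stirling (+ n)) (m-n≡m∸n t≤n))
  (subst (λ x → S₂ x (n ∸ t) ≡ staircase x t) (m∸n+n≡m t≤n) (S₂-staircase (n ∸ t) t))
... | no t≰n = trans (negative n t (≰⇒> t≰n)) (sym (staircase-zero (≰⇒> t≰n)))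
  where
  negative : ∀ n t → n < t → stirling (+ n) (+ n -ℤ + t) ≡ 0
  negative n t n<t with t ∸ n | m<n⇒0<n∸m n<t | trans (ℤ.m-n≡m⊖n n t) (ℤ.⊖-< n<t)
  ... | suc e | _ | eq = trans (cong (stirling (+ n)) eq) (stirling-negative n e)

-- Staircases with extra cells.

-- Placements of j rooks on a staircase board of n columns, h of which are
-- one cell higher (which ones does not matter).  The recursion on h deletes an
-- extra cell, or puts a rook on it; in the latter case its row and column
-- disappear and a staircase board of n − 1 columns is left.  Meaningful only
-- for h ≤ n.
bumpy : ℕ → ℕ → ℕ → ℕ
bumpy h       n       zero    = 1
bumpy zero    n       (suc j) = staircase n (suc j)
bumpy (suc h) zero    (suc j) = 0
bumpy (suc h) (suc n) (suc j) = bumpy h (suc n) (suc j) + bumpy h n j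

bumpy-zero : ∀ {h n j} → h ≤ n → n < j → bumpy h n j ≡ 0
bumpy-zero {zero}  {n}     {suc j} _         n<j       = staircase-zero n<j
bumpy-zero {suc h} {suc n} {suc j} (s≤s h≤n) (s≤s n<j) =
  cong₂ _+_ (bumpy-zero (m≤n⇒m≤1+n h≤n) (s≤s n<j)) (bumpy-zero h≤n n<j)

-- The new column, of height n, is not raised, and j rooks before it leave n - j of its rows free.
-- In the induction on `h` both terms of the recursion carry the same factor because `n` and `j`
-- drop together.
bumpy-flat : ∀ {h n} j → h ≤ n →
  bumpy h (suc n) (suc j) ≡ bumpy h n (suc j) + (n ∸ j) * bumpy h n j
bumpy-flat {zero} zero    _ = refl
bumpy-flat {zero} (suc j) _ = refl
bumpy-flat {suc h} {suc n} zero (s≤s h≤n)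
  rewrite bumpy-flat {h} {suc n} zero (m≤n⇒m≤1+n h≤n) =
  solve 2 (λ a b → a :+ b :+ con 1 := a :+ con 1 :+ b) refl (bumpy h (suc n) 1) (suc n * 1)
bumpy-flat {suc h} {suc n} (suc j) (s≤s h≤n) = begin
  bumpy h (2 + n) (2 + j) + bumpy h (suc n) (suc j)
    ≡⟨ cong₂ _+_ (bumpy-flat (suc j) (m≤n⇒m≤1+n h≤n)) (bumpy-flat j h≤n) ⟩
  (bumpy h (suc n) (2 + j) + (n ∸ j) * bumpy h (suc n) (suc j)) + (bumpy h n (suc j) + (n ∸ j) * bumpy h n j)
    ≡⟨ solve 5 (λ a b c d e → (a :+ e :* b) :+ (c :+ e :* d) := a :+ c :+ e :* (b :+ d)) refl
         (bumpy h (suc n) (2 + j)) (bumpy h (suc n) (suc j)) (bumpy h n (suc j)) (bumpy h n j) (n ∸ j) ⟩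
  bumpy h (suc n) (2 + j) + bumpy h n (suc j) + (n ∸ j) * (bumpy h (suc n) (suc j) + bumpy h n j) ∎
  where open ≡-Reasoning

-- Raising the last column adds its extra cell to the count of `bumpy-flat`, hence one more free
-- row.
bumpy-raised : ∀ {h n} j → h ≤ n →
  bumpy (suc h) (suc n) (suc j) ≡ bumpy h n (suc j) + (suc n ∸ j) * bumpy h n j
bumpy-raised {h} {n} j h≤n with j ≤? n
... | yes j≤n rewrite bumpy-flat j h≤n | +-∸-assoc 1 j≤n =
  trans (+-assoc (bumpy h n (suc j)) _ _) (cong (_+_ (bumpy h n (suc j))) (+-comm ((n ∸ j) * bumpy h n j) _))
-- Here `suc n ∸ j` is 0 instead of `suc (n ∸ j)`, but the factor `bumpy h n j` is 0.
... | no j≰n rewrite bumpy-flat j h≤n | bumpy-zero h≤n (≰⇒> j≰n) | *-zeroʳ (n ∸ j) | *-zeroʳ (suc n ∸ j) =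
  +-identityʳ _

-- Unrolling the recursion on `h`: each of the i occupied extra cells costs one column and one rook,
-- and Pascal's rule merges the choices.
bumpy-∑ : ∀ {h n} j → h ≤ n →
  bumpy h n j ≡ ∑[ i ≤ j ] ((h C i) * staircase (n ∸ i) (j ∸ i))
bumpy-∑ {zero}  zero    _ = refl
bumpy-∑ {suc h} zero    _ = refl
bumpy-∑ {zero} {n} (suc j) _ = begin
  staircase n (suc j)
    ≡⟨ solve 1 (λ a → a := con 1 :* a :+ con 0) refl (staircase n (suc j)) ⟩
  1 * staircase n (suc j) + 0
    ≡⟨ cong (_+_ (1 * staircase n (suc j))) (∑₀-vanish j λ i → cong (_* staircase (n ∸ suc i) (j ∸ i)) (k>n⇒nCk≡0 {0} {suc i} (s≤s z≤n))) ⟨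
  1 * staircase n (suc j) + ∑₀ j (λ i → (0 C suc i) * staircase (n ∸ suc i) (j ∸ i))
    ≡⟨ ∑₀-suc j (λ i → (0 C i) * staircase (n ∸ i) (suc j ∸ i)) ⟨
  ∑[ i ≤ suc j ] ((0 C i) * staircase (n ∸ i) (suc j ∸ i)) ∎
  where open ≡-Reasoning
bumpy-∑ {suc h} {suc n} (suc j) (s≤s h≤n) = begin
  bumpy h (suc n) (suc j) + bumpy h n j
    ≡⟨ cong₂ _+_ (trans (bumpy-∑ (suc j) (m≤n⇒m≤1+n h≤n)) (∑₀-suc j (λ i → (h C i) * v i))) (bumpy-∑ j h≤n) ⟩
  (h C 0) * staircase (suc n) (suc j) + ∑₀ j (λ i → (h C suc i) * w i) + ∑₀ j (λ i → (h C i) * w i)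
    ≡⟨ +-assoc ((h C 0) * staircase (suc n) (suc j)) _ _ ⟩
  (h C 0) * staircase (suc n) (suc j) + (∑₀ j (λ i → (h C suc i) * w i) + ∑₀ j (λ i → (h C i) * w i))
    ≡⟨ cong (_+_ ((h C 0) * staircase (suc n) (suc j))) (∑₀-+ j (λ i → (h C suc i) * w i) (λ i → (h C i) * w i)) ⟨
  (h C 0) * staircase (suc n) (suc j) + ∑₀ j (λ i → (h C suc i) * w i + (h C i) * w i)
    ≡⟨ cong (_+_ ((h C 0) * staircase (suc n) (suc j))) (∑₀-cong j λ i _ → pascal i) ⟩
  (suc h C 0) * staircase (suc n) (suc j) + ∑₀ j (λ i → (suc h C suc i) * w i)
    ≡⟨ ∑₀-suc j (λ i → (suc h C i) * v i) ⟨
  ∑[ i ≤ suc j ] ((suc h C i) * staircase (suc n ∸ i) (suc j ∸ i)) ∎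
  where
  open ≡-Reasoning
  v w : ℕ → ℕ
  v i = staircase (suc n ∸ i) (suc j ∸ i)
  w i = staircase (n ∸ i) (j ∸ i)
  pascal : ∀ i → (h C suc i) * w i + (h C i) * w i ≡ (suc h C suc i) * w i
  pascal i = trans (sym (*-distribʳ-+ (w i) (h C suc i) (h C i)))
    (cong (_* w i) (trans (+-comm (h C suc i) (h C i)) (nCk+nC[k+1]≡[n+1]C[k+1] h i)))

m∸i-[j∸i]≡m-j : ∀ {i j m} → i ≤ j → i ≤ m → + (m ∸ i) -ℤ + (j ∸ i) ≡ + m -ℤ + j
m∸i-[j∸i]≡m-j {i} {j} {m} i≤j i≤m = begin
  + (m ∸ i) -ℤ + (j ∸ i)                        ≡⟨ ℤ.m-n≡m⊖n (m ∸ i) (j ∸ i) ⟩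
  (m ∸ i) ⊖ (j ∸ i)           ≡⟨ ℤ.+-cancelˡ-⊖ i (m ∸ i) (j ∸ i) ⟨
  (i + (m ∸ i)) ⊖ (i + (j ∸ i)) ≡⟨ cong₂ _⊖_ (m+[n∸m]≡n i≤m) (m+[n∸m]≡n i≤j) ⟩
  m ⊖ j                       ≡⟨ ℤ.m-n≡m⊖n m j ⟨
  + m -ℤ + j ∎
  where open ≡-Reasoning

bumpy-stirling : ∀ {h m} j → h ≤ m →
  bumpy h m j ≡ ∑[ i ≤ j ] ((h C i) * stirling (+ m -ℤ + i) (+ m -ℤ + j))
bumpy-stirling {h} {m} j h≤m = trans (bumpy-∑ j h≤m) (∑₀-cong j term)
  where
  term : ∀ i → i ≤ j →
    (h C i) * staircase (m ∸ i) (j ∸ i) ≡ (h C i) * stirling (+ m -ℤ + i) (+ m -ℤ + j)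
  term i i≤j with i ≤? m
  ... | yes i≤m = cong ((h C i) *_) (trans (sym (stirling-staircase (m ∸ i) (j ∸ i)))
    (cong₂ stirling (sym (m-n≡m∸n i≤m)) (m∸i-[j∸i]≡m-j i≤j i≤m)))
  -- Here `m ∸ i` is not m - i, but i > m ≥ h makes the binomial coefficient 0.
  ... | no i≰m rewrite k>n⇒nCk≡0 (≤-<-trans h≤m (≰⇒> i≰m)) = refl

-- Nonattacking rooks on a list of cells.

Cell : Set
Cell = ℕ × ℕ

Apart : Cell → Cell → Set
Apart (d , s) (d′ , s′) = d ≢ d′ × s ≢ s′

apart? : ∀ x y → Dec (Apart x y)
apart? (d , s) (d′ , s′) = ¬? (d ≟ d′) ×-dec ¬? (s ≟ s′)

apart : Cell → Cell → Bool
apart x y = does (apart? x y)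

Apart-sym : ∀ {x y} → Apart x y → Apart y x
Apart-sym (d≢ , s≢) = d≢ ∘ sym , s≢ ∘ sym

apart-sym : ∀ x y → apart x y ≡ apart y x
apart-sym x y = does-⇔ (mk⇔ Apart-sym Apart-sym) (apart? x y) (apart? y x)

-- Availability is a predicate separate from the list of cells: a rook only narrows the predicate,
-- so `rooks` can recurse on the list.
_without_ : (Cell → Bool) → Cell → Cell → Bool
(a without x) y = a y ∧ apart x y

without-apart : ∀ a x y → Apart x y → (a without x) y ≡ a y
without-apart a x y p = trans (cong (a y ∧_) (dec-true (apart? x y) p)) (∧-identityʳ (a y))

without-attacked : ∀ a x y → ¬ Apart x y → (a without x) y ≡ false
without-attacked a x y ¬p = trans (cong (a y ∧_) (dec-false (apart? x y) ¬p)) (∧-zeroʳ (a y))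

without⁻ : ∀ a x y → (a without x) y ≡ true → a y ≡ true × Apart x y
without⁻ a x y eq with apart? x y
... | yes p = trans (sym (without-apart a x y p)) eq , p
... | no ¬p with () ← trans (sym eq) (without-attacked a x y ¬p)

-- Placements of k nonattacking rooks on the listed cells x with a x ≡ true.
rooks : List Cell → (Cell → Bool) → ℕ → ℕ
rooks L       a zero    = 1
rooks []      a (suc k) = 0
rooks (x ∷ L) a (suc k) =
  rooks L a (suc k) + (if a x then rooks L (a without x) k else 0)

if-cong : ∀ {b b′ : Bool} {x y : ℕ} → b ≡ b′ → (b ≡ true → x ≡ y) →
  (if b then x else 0) ≡ (if b′ then y else 0)
if-cong {true}  refl x≡y = x≡y refl
if-cong {false} refl _   = refl

rooks-cong : ∀ L {a b} k → (∀ {x} → x ∈ L → a x ≡ b x) → rooks L a k ≡ rooks L b k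
rooks-cong L       zero    a≡b = refl
rooks-cong []      (suc k) a≡b = refl
rooks-cong (x ∷ L) (suc k) a≡b = cong₂ _+_ (rooks-cong L (suc k) (a≡b ∘ there))
  (if-cong (a≡b (here refl)) λ _ →
    rooks-cong L k λ {y} y∈L → cong (_∧ apart x y) (a≡b (there y∈L)))

without-comm : ∀ a x y z → ((a without x) without y) z ≡ ((a without y) without x) z
without-comm a x y z = begin
  (a z ∧ apart x z) ∧ apart y z ≡⟨ ∧-assoc (a z) _ _ ⟩
  a z ∧ (apart x z ∧ apart y z) ≡⟨ cong (a z ∧_) (∧-comm (apart x z) _) ⟩
  a z ∧ (apart y z ∧ apart x z) ≡⟨ ∧-assoc (a z) _ _ ⟨
  (a z ∧ apart y z) ∧ apart x z ∎
  where open ≡-Reasoning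

if-+ : ∀ b {x y : ℕ} →
  (if b then x + y else 0) ≡ (if b then x else 0) + (if b then y else 0)
if-+ true  = refl
if-+ false = refl

if-if : ∀ b c {x : ℕ} →
  (if b then (if c then x else 0) else 0) ≡ (if b ∧ c then x else 0)
if-if true  c = refl
if-if false c = refl

-- The four terms sort the placements by which of `x` and `y` are occupied, which exposes the
-- symmetry needed for `rooks-swap`.
rooks-two : ∀ L x y a k → rooks (x ∷ y ∷ L) a (2 + k) ≡
  rooks L a (2 + k) + (if a y then rooks L (a without y) (suc k) else 0) +
  ((if a x then rooks L (a without x) (suc k) else 0) +
   (if a x ∧ (a y ∧ apart x y) then rooks L ((a without x) without y) k else 0))
rooks-two L x y a k = cong (_+_ (rooks (y ∷ L) a (2 + k)))
  (trans (if-+ (a x)) (cong (_+_ (if a x then rooks L (a without x) (suc k) else 0)) (if-if (a x) _)))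

rooks-swap : ∀ L x y a k → rooks (x ∷ y ∷ L) a k ≡ rooks (y ∷ x ∷ L) a k
rooks-swap L x y a zero = refl
rooks-swap L x y a (suc zero) =
  solve 3 (λ p q r → p :+ q :+ r := p :+ r :+ q) refl (rooks L a 1)
    (if a y then 1 else 0) (if a x then 1 else 0)
rooks-swap L x y a (suc (suc k)) = begin
  rooks (x ∷ y ∷ L) a (2 + k)
    ≡⟨ rooks-two L x y a k ⟩
  rooks L a (2 + k) + one y + (one x + both x y)
    ≡⟨ cong (λ t → rooks L a (2 + k) + one y + (one x + t)) (if-cong conditions λ _ →
         rooks-cong L k λ {z} _ → without-comm a x y z) ⟩
  rooks L a (2 + k) + one y + (one x + both y x)
    ≡⟨ solve 4 (λ p q r t → p :+ q :+ (r :+ t) := p :+ r :+ (q :+ t)) refl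
         (rooks L a (2 + k)) (one y) (one x) (both y x) ⟩
  rooks L a (2 + k) + one x + (one y + both y x)
    ≡⟨ rooks-two L y x a k ⟨
  rooks (y ∷ x ∷ L) a (2 + k) ∎
  where
  open ≡-Reasoning
  one : Cell → ℕ
  one u = if a u then rooks L (a without u) (suc k) else 0
  both : Cell → Cell → ℕ
  both u v = if a u ∧ (a v ∧ apart u v) then rooks L ((a without u) without v) k else 0
  conditions : a x ∧ (a y ∧ apart x y) ≡ a y ∧ (a x ∧ apart y x)
  conditions rewrite apart-sym x y = begin
    a x ∧ (a y ∧ apart y x) ≡⟨ ∧-assoc (a x) _ _ ⟨
    (a x ∧ a y) ∧ apart y x ≡⟨ cong (_∧ apart y x) (∧-comm (a x) _) ⟩
    (a y ∧ a x) ∧ apart y x ≡⟨ ∧-assoc (a y) _ _ ⟩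
    a y ∧ (a x ∧ apart y x) ∎

rooks-prep : ∀ x {L L′} a k → (∀ a k → rooks L a k ≡ rooks L′ a k) →
  rooks (x ∷ L) a k ≡ rooks (x ∷ L′) a k
rooks-prep x a zero    L≡L′ = refl
rooks-prep x a (suc k) L≡L′ =
  cong₂ _+_ (L≡L′ a (suc k)) (if-cong {a x} refl λ _ → L≡L′ (a without x) k)

-- Permits relisting the squares of the board colour by colour and diagonal by diagonal.
rooks-↭ : ∀ {L L′} → L ↭ L′ → ∀ a k → rooks L a k ≡ rooks L′ a k
rooks-↭ Perm.refl           a k = refl
rooks-↭ (Perm.prep x p)     a k = rooks-prep x a k (rooks-↭ p)
rooks-↭ (Perm.swap x y p)   a k = trans
  (rooks-prep x a k λ a k → rooks-prep y a k (rooks-↭ p)) (rooks-swap _ x y a k)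
rooks-↭ (Perm.trans p q)    a k = trans (rooks-↭ p a k) (rooks-↭ q a k)

rooks-blocked : ∀ L {a} k → (∀ {x} → x ∈ L → a x ≡ false) → rooks L a (suc k) ≡ 0
rooks-blocked []      k a≡f = refl
rooks-blocked (x ∷ L) k a≡f rewrite a≡f (here refl) =
  trans (+-identityʳ _) (rooks-blocked L k (a≡f ∘ there))

-- A rook on `L` attacks nothing in `M`, so it leaves the availability on `M` as it was; a placement
-- splits into two independent ones, with j rooks on `L`.
rooks-++ : ∀ L M a k → (∀ {x y} → x ∈ L → y ∈ M → Apart x y) →
  rooks (L ++ M) a k ≡ ∑[ j ≤ k ] (rooks L a j * rooks M a (k ∸ j))
rooks-++ []      M a zero    _ = refl
rooks-++ []      M a (suc k) _ = begin
  rooks M a (suc k)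
    ≡⟨ solve 1 (λ p → p := con 1 :* p :+ con 0) refl (rooks M a (suc k)) ⟩
  1 * rooks M a (suc k) + 0
    ≡⟨ cong (_+_ (1 * rooks M a (suc k))) (∑₀-vanish k {λ j → 0 * rooks M a (k ∸ j)} λ _ → refl) ⟨
  1 * rooks M a (suc k) + ∑₀ k (λ j → 0 * rooks M a (k ∸ j))
    ≡⟨ ∑₀-suc k (λ j → rooks [] a j * rooks M a (suc k ∸ j)) ⟨
  ∑[ j ≤ suc k ] (rooks [] a j * rooks M a (suc k ∸ j)) ∎
  where open ≡-Reasoning
rooks-++ (x ∷ L) M a zero    _     = refl
rooks-++ (x ∷ L) M a (suc k) L∣M = begin
  rooks (L ++ M) a (suc k) + (if a x then rooks (L ++ M) a′ k else 0)
    ≡⟨ cong₂ _+_ (trans (rooks-++ L M a (suc k) (L∣M ∘ there))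
         (∑₀-suc k λ j → rooks L a j * r (suc k ∸ j))) with-x ⟩
  1 * r (suc k) + ∑₀ k (λ j → rooks L a (suc j) * r (k ∸ j)) + ∑₀ k (λ j → g j * r (k ∸ j))
    ≡⟨ +-assoc (1 * r (suc k)) _ _ ⟩
  1 * r (suc k) + (∑₀ k (λ j → rooks L a (suc j) * r (k ∸ j)) + ∑₀ k (λ j → g j * r (k ∸ j)))
    ≡⟨ cong (_+_ (1 * r (suc k))) (∑₀-+ k (λ j → rooks L a (suc j) * r (k ∸ j)) (λ j → g j * r (k ∸ j))) ⟨
  1 * r (suc k) + ∑₀ k (λ j → rooks L a (suc j) * r (k ∸ j) + g j * r (k ∸ j))
    ≡⟨ cong (_+_ (1 * r (suc k))) (∑₀-cong k λ j _ → *-distribʳ-+ (r (k ∸ j)) (rooks L a (suc j)) (g j)) ⟨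
  1 * r (suc k) + ∑₀ k (λ j → rooks (x ∷ L) a (suc j) * r (k ∸ j))
    ≡⟨ ∑₀-suc k (λ j → rooks (x ∷ L) a j * r (suc k ∸ j)) ⟨
  ∑[ j ≤ suc k ] (rooks (x ∷ L) a j * r (suc k ∸ j)) ∎
  where
  open ≡-Reasoning
  a′ = a without x
  r : ℕ → ℕ
  r = rooks M a
  g : ℕ → ℕ
  g j = if a x then rooks L a′ j else 0
  undisturbed : ∀ {y} → y ∈ M → a′ y ≡ a y
  undisturbed {y} y∈M = without-apart a x y (L∣M (here refl) y∈M)
  with-x : (if a x then rooks (L ++ M) a′ k else 0) ≡ ∑₀ k (λ j → g j * r (k ∸ j))
  with-x with a x
  ... | false = sym (∑₀-vanish k {λ j → 0 * r (k ∸ j)} λ _ → refl)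
  ... | true  = trans (rooks-++ L M a′ k (L∣M ∘ there))
    (∑₀-cong k λ j _ → cong (rooks L a′ j *_) (rooks-cong M (k ∸ j) undisturbed))

-- Adding a last column.

count : (ℕ → Bool) → List ℕ → ℕ
count b []       = 0
count b (s ∷ ss) = (if b s then 1 else 0) + count b ss

count-cong : ∀ {b b′} ss → (∀ {s} → s ∈ ss → b s ≡ b′ s) → count b ss ≡ count b′ ss
count-cong []       _    = refl
count-cong (s ∷ ss) b≡b′ = cong₂ _+_ (cong (if_then 1 else 0) (b≡b′ (here refl))) (count-cong ss (b≡b′ ∘ there))

count-const-true : ∀ ss → count (const true) ss ≡ length ss
count-const-true []       = refl
count-const-true (s ∷ ss) = cong suc (count-const-true ss)

-- Serves for the one cell of the last column in the row of a new rook; as `ss` has no repetitions,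
-- a single summand changes.
count-remove : ∀ {b b′ s ss} → Unique ss → s ∈ ss → b s ≡ true → b′ s ≡ false →
  (∀ {t} → t ≢ s → b′ t ≡ b t) → count b ss ≡ suc (count b′ ss)
count-remove {ss = _ ∷ ss} (s∉ss ∷ _) (here refl) bs b′s b′≡b rewrite bs | b′s =
  cong suc (count-cong ss λ t∈ss → sym (b′≡b (All.lookup s∉ss t∈ss ∘ sym)))
count-remove {b} {b′} {s} {t ∷ ss} (t∉ss ∷ u) (there s∈ss) bs b′s b′≡b
  rewrite b′≡b (All.lookup t∉ss s∈ss) | count-remove {b} {b′} u s∈ss bs b′s b′≡b =
  +-suc (if b t then 1 else 0) _

column-one : ∀ d ss a → rooks (map (d ,_) ss) a 1 ≡ count (λ s → a (d , s)) ss
column-one d []       a = refl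
column-one d (s ∷ ss) a = trans (+-comm _ (if a (d , s) then 1 else 0))
  (cong (_+_ (if a (d , s) then 1 else 0)) (column-one d ss a))

column-two : ∀ d ss a k → rooks (map (d ,_) ss) a (2 + k) ≡ 0
column-two d []       a k = refl
column-two d (s ∷ ss) a k = cong₂ _+_ (column-two d ss a k) (blocked (a (d , s)))
  where
  blocked : ∀ b → (if b then rooks (map (d ,_) ss) (a without (d , s)) (suc k) else 0) ≡ 0
  blocked false = refl
  blocked true  = rooks-blocked (map (d ,_) ss) k same
    where
    same : ∀ {y} → y ∈ map (d ,_) ss → (a without (d , s)) y ≡ false
    same {y} y∈ with _ , _ , refl ← ∈-map⁻ (d ,_) y∈ =
      without-attacked a (d , s) y λ (d≢ , _) → d≢ refl

-- k rooks placed before a last column whose rows include all those of the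
-- earlier ones occupy exactly k of its rows.
add-column : ∀ L d ss a k → Unique ss →
  (∀ {x} → x ∈ L → proj₁ x ≢ d × proj₂ x ∈ ss) →
  (∀ {x} → x ∈ L → a x ≡ true → a (d , proj₂ x) ≡ true) →
  rooks (L ++ map (d ,_) ss) a (suc k) ≡
  rooks L a (suc k) + (count (λ s → a (d , s)) ss ∸ k) * rooks L a k
add-column []      d ss a zero    u _ _ = trans (column-one d ss a) (sym (*-identityʳ _))
add-column []      d ss a (suc k) u _ _ = trans (column-two d ss a k)
  (sym (*-zeroʳ (count (λ s → a (d , s)) ss ∸ suc k)))
add-column (x ∷ L) d ss a zero    u low free
  rewrite add-column L d ss a zero u (low ∘ there) (free ∘ there) =
  solve 3 (λ p q r → p :+ q :+ r := p :+ r :+ q) refl (rooks L a 1) _ (if a x then 1 else 0)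
add-column (x ∷ L) d ss a (suc k) u low free
  rewrite add-column L d ss a (suc k) u (low ∘ there) (free ∘ there)
  with a x in ax
... | false =
  solve 3 (λ p q t → p :+ t :* q :+ con 0 := p :+ con 0 :+ t :* (q :+ con 0)) refl
    (rooks L a (2 + k)) (rooks L a (suc k)) (count (λ s → a (d , s)) ss ∸ suc k)
... | true = begin
  rooks L a (2 + k) + (c ∸ suc k) * rooks L a (suc k) + rooks (L ++ map (d ,_) ss) a′ (suc k)
    ≡⟨ cong (_+_ (rooks L a (2 + k) + (c ∸ suc k) * rooks L a (suc k)))
         (add-column L d ss a′ k u (low ∘ there) still-free) ⟩
  rooks L a (2 + k) + (c ∸ suc k) * rooks L a (suc k) + (rooks L a′ (suc k) + (c′ ∸ k) * rooks L a′ k)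
    ≡⟨ cong (λ t → rooks L a (2 + k) + (c ∸ suc k) * rooks L a (suc k) + (rooks L a′ (suc k) + (t ∸ suc k) * rooks L a′ k)) one-less ⟨
  rooks L a (2 + k) + (c ∸ suc k) * rooks L a (suc k) + (rooks L a′ (suc k) + (c ∸ suc k) * rooks L a′ k)
    ≡⟨ solve 5 (λ p q r s t → p :+ t :* q :+ (r :+ t :* s) := p :+ r :+ t :* (q :+ s)) refl
         (rooks L a (2 + k)) (rooks L a (suc k)) (rooks L a′ (suc k)) (rooks L a′ k) (c ∸ suc k) ⟩
  rooks L a (2 + k) + rooks L a′ (suc k) + (c ∸ suc k) * (rooks L a (suc k) + rooks L a′ k) ∎
  where
  open ≡-Reasoning
  a′ = a without x
  c c′ : ℕ
  c  = count (λ s → a (d , s)) ss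
  c′ = count (λ s → a′ (d , s)) ss
  x-off = proj₁ (low (here refl))
  keep : ∀ {s} → s ≢ proj₂ x → a′ (d , s) ≡ a (d , s)
  keep {s} s≢ = without-apart a x (d , s) (x-off , s≢ ∘ sym)
  -- The rook on `x` attacks exactly one available cell of the last column, the one in its row;
  -- hence `c′ ∸ k`, which is `suc c′ ∸ suc k`, equals `c ∸ suc k`.
  one-less : c ≡ suc c′
  one-less = count-remove u (proj₂ (low (here refl))) (free (here refl) ax)
    (without-attacked a x (d , proj₂ x) λ (_ , s≢) → s≢ refl)
    keep
  -- A cell still available is not in the row of `x`, so its row in the last column stays available
  -- too.
  still-free : ∀ {y} → y ∈ L → a′ y ≡ true → a′ (d , proj₂ y) ≡ true
  still-free {y} y∈L a′y with ay , (_ , s≢) ← without⁻ a x y a′y =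
    trans (keep (s≢ ∘ sym)) (free (there y∈L) ay)

-- Counting subsets by rook numbers.

Placement : ∀ {n} → (Fin n → Cell) → (Cell → Bool) → ℕ → Subset n → Set
Placement f a k p = ∣ p ∣ ≡ k × (∀ s → s Subset.∈ p → a (f s) ≡ true) ×
  (∀ s t → s Subset.∈ p → t Subset.∈ p → s ≢ t → Apart (f s) (f t))

length-filter-map : ∀ {A B : Set} {P : B → Set} (P? : Decidable P) (g : A → B) xs →
  length (filter P? (map g xs)) ≡ length (filter (P? ∘ g) xs)
length-filter-map P? g [] = refl
length-filter-map P? g (x ∷ xs) with does (P? (g x))
... | true  = cong suc (length-filter-map P? g xs)
... | false = length-filter-map P? g xs

placement-out : ∀ {n} (f : Fin (suc n) → Cell) a k p →
  Placement f a k (outside ∷ p) ⇔ Placement (f ∘ suc) a k p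
placement-out f a k p = mk⇔
  (λ (size , admitted , apart) → size , (λ s s∈p → admitted (suc s) (there s∈p)) ,
    λ s t s∈p t∈p s≢t → apart (suc s) (suc t) (there s∈p) (there t∈p) (s≢t ∘ Fin-suc-injective))
  (λ (size , admitted , apart) → size ,
    (λ { (suc s) (there s∈p) → admitted s s∈p }) ,
    λ { (suc s) (suc t) (there s∈p) (there t∈p) s≢t → apart s t s∈p t∈p (s≢t ∘ cong suc) })

-- Being apart from the occupied first cell becomes a condition on the availability of each later
-- cell.
placement-in : ∀ {n} (f : Fin (suc n) → Cell) a k p → a (f zero) ≡ true →
  Placement f a (suc k) (inside ∷ p) ⇔ Placement (f ∘ suc) (a without f zero) k p
placement-in f a k p a0 = mk⇔
  (λ (size , admitted , apart) → ℕ-suc-injective size ,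
    (λ s s∈p → trans (without-apart a (f zero) (f (suc s)) (apart zero (suc s) here (there s∈p) λ ()))
      (admitted (suc s) (there s∈p))) ,
    λ s t s∈p t∈p s≢t → apart (suc s) (suc t) (there s∈p) (there t∈p) (s≢t ∘ Fin-suc-injective))
  (λ (size , admitted , apart) → cong suc size ,
    (λ { zero here → a0
       ; (suc s) (there s∈p) → proj₁ (without⁻ a (f zero) (f (suc s)) (admitted s s∈p)) }) ,
    λ { zero zero _ _ s≢t → ⊥-elim (s≢t refl)
      ; zero (suc t) _ (there t∈p) _ → proj₂ (without⁻ a (f zero) (f (suc t)) (admitted t t∈p))
      ; (suc s) zero (there s∈p) _ _ → Apart-sym (proj₂ (without⁻ a (f zero) (f (suc s)) (admitted s s∈p)))
      ; (suc s) (suc t) (there s∈p) (there t∈p) s≢t → apart s t s∈p t∈p (s≢t ∘ cong suc) })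

-- Subsets without and with the first element give the two terms of the recursion of `rooks`. `P`
-- stays abstract so that the induction can pass to its restrictions with their own decision
-- procedures.
count-placements : ∀ n (f : Fin n → Cell) a k {P : Subset n → Set} (P? : Decidable P) →
  (∀ p → P p ⇔ Placement f a k p) → length (filter P? (subsets n)) ≡ rooks (tabulate f) a k
count-placements zero f a k P? P⇔ with P? []
count-placements zero f a zero    P? P⇔ | yes _ = refl
count-placements zero f a zero    P? P⇔ | no ¬p =
  ⊥-elim (¬p (from (P⇔ []) (refl , (λ ()) , λ ())))
count-placements zero f a (suc k) P? P⇔ | yes p with () ← proj₁ (to (P⇔ []) p)
count-placements zero f a (suc k) P? P⇔ | no _ = refl
count-placements (suc n) f a k {P} P? P⇔ = begin
  length (filter P? (map (inside ∷_) (subsets n) ++ map (outside ∷_) (subsets n)))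
    ≡⟨ cong length (filter-++ P? (map (inside ∷_) (subsets n)) _) ⟩
  length (filter P? (map (inside ∷_) (subsets n)) ++ filter P? (map (outside ∷_) (subsets n)))
    ≡⟨ length-++ (filter P? (map (inside ∷_) (subsets n))) ⟩
  length (filter P? (map (inside ∷_) (subsets n))) + length (filter P? (map (outside ∷_) (subsets n)))
    ≡⟨ cong₂ _+_ (length-filter-map P? (inside ∷_) (subsets n)) (length-filter-map P? (outside ∷_) (subsets n)) ⟩
  length (filter (P? ∘ (inside ∷_)) (subsets n)) + length (filter (P? ∘ (outside ∷_)) (subsets n))
    ≡⟨ cong₂ _+_ refl (count-placements n (f ∘ suc) a k (P? ∘ (outside ∷_))
         λ p → mk⇔ (to (placement-out f a k p) ∘ to (P⇔ _)) (from (P⇔ _) ∘ from (placement-out f a k p))) ⟩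
  length (filter (P? ∘ (inside ∷_)) (subsets n)) + rooks (tabulate (f ∘ suc)) a k
    ≡⟨ with-zero k P⇔ ⟩
  rooks (tabulate f) a k ∎
  where
  open ≡-Reasoning
  none : (∀ p → ¬ P (inside ∷ p)) → length (filter (P? ∘ (inside ∷_)) (subsets n)) ≡ 0
  none ¬P = cong length (filter-none (P? ∘ (inside ∷_)) (All.universal ¬P (subsets n)))
  with-zero : ∀ k → (∀ p → P p ⇔ Placement f a k p) →
    length (filter (P? ∘ (inside ∷_)) (subsets n)) + rooks (tabulate (f ∘ suc)) a k ≡ rooks (tabulate f) a k
  with-zero zero    P⇔ = cong (_+ 1) (none λ p Pp → 1+n≢0 (proj₁ (to (P⇔ _) Pp)))
  with-zero (suc k) P⇔ = trans (+-comm _ (rooks (tabulate (f ∘ suc)) a (suc k)))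
    (cong (_+_ (rooks (tabulate (f ∘ suc)) a (suc k))) first)
    where
    first : length (filter (P? ∘ (inside ∷_)) (subsets n)) ≡
      (if a (f zero) then rooks (tabulate (f ∘ suc)) (a without f zero) k else 0)
    first with a (f zero) in a0
    ... | true  = count-placements n (f ∘ suc) (a without f zero) k (P? ∘ (inside ∷_))
      λ p → mk⇔ (to (placement-in f a k p a0) ∘ to (P⇔ _)) (from (P⇔ _) ∘ from (placement-in f a k p a0))
    ... | false = none λ p Pp → false≢true (trans (sym a0) (proj₁ (proj₂ (to (P⇔ _) Pp)) zero here))
      where
      false≢true : false ≢ true
      false≢true ()

-- The board in diagonal coordinates.

module Board (m : ℕ) where

  -- The difference i − j is shifted by m to stay in ℕ.
  rotate : ℕ → ℕ → Cell
  rotate i j = i + (m ∸ j) , i + j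

  cell : Square m → Cell
  cell s = rotate (toℕ (proj₁ (remQuot {m} m s))) (toℕ (proj₂ (remQuot {m} m s)))

  difference : ∀ i {j} → j < m → + suc i -ℤ + suc j +ℤ + m ≡ + (i + (m ∸ j))
  difference i {j} j<m = begin
    + suc i -ℤ + suc j +ℤ + m ≡⟨ cong (_+ℤ + m) (trans (ℤ.m-n≡m⊖n (suc i) (suc j)) (ℤ.[1+m]⊖[1+n]≡m⊖n i j)) ⟩
    (i ⊖ j) +ℤ + m            ≡⟨ ℤ.distribˡ-⊖-+-pos m i j ⟩
    (i + m) ⊖ j               ≡⟨ ℤ.⊖-≥ (≤-trans (<⇒≤ j<m) (m≤n+m m i)) ⟩
    + (i + m ∸ j)             ≡⟨ cong +_ (+-∸-assoc i (<⇒≤ j<m)) ⟩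
    + (i + (m ∸ j))           ∎
    where open ≡-Reasoning

  difference-⇔ : ∀ i i′ {j j′} → j < m → j′ < m →
    (+ suc i -ℤ + suc j ≡ + suc i′ -ℤ + suc j′) ⇔ (i + (m ∸ j) ≡ i′ + (m ∸ j′))
  difference-⇔ i i′ j<m j′<m = mk⇔
    (λ eq → ℤ.+-injective (trans (sym (difference i j<m)) (trans (cong (_+ℤ + m) eq) (difference i′ j′<m))))
    (λ eq → +ℤ-cancelʳ (+ m) _ _ (trans (difference i j<m) (trans (cong +_ eq) (sym (difference i′ j′<m)))))

  sum-⇔ : ∀ i i′ j j′ → (+ suc i +ℤ + suc j ≡ + suc i′ +ℤ + suc j′) ⇔ (i + j ≡ i′ + j′)
  sum-⇔ i i′ j j′ = mk⇔
    (λ eq → ℕ-suc-injective (ℕ-suc-injective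
      (trans (sym (cong suc (+-suc i j))) (trans (ℤ.+-injective eq) (cong suc (+-suc i′ j′))))))
    (λ eq → cong +_ (trans (cong suc (+-suc i j)) (trans (cong (_+_ 2) eq) (sym (cong suc (+-suc i′ j′))))))

  apart-⇔ : ∀ s t → (¬ SameDiagonal {m} s t) ⇔ Apart (cell s) (cell t)
  apart-⇔ s t = mk⇔
    (λ ¬same → ¬same ∘ inj₁ ∘ from differences , ¬same ∘ inj₂ ∘ from sums)
    (λ (d≢ , s≢) → [ d≢ ∘ to differences , s≢ ∘ to sums ]′)
    where
    differences = difference-⇔ (toℕ (proj₁ (remQuot {m} m s))) (toℕ (proj₁ (remQuot {m} m t)))
      (toℕ<n (proj₂ (remQuot {m} m s))) (toℕ<n (proj₂ (remQuot {m} m t)))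
    sums = sum-⇔ (toℕ (proj₁ (remQuot {m} m s))) (toℕ (proj₁ (remQuot {m} m t)))
      (toℕ (proj₂ (remQuot {m} m s))) (toℕ (proj₂ (remQuot {m} m t)))

  B-rooks : ∀ k → B m k ≡ rooks (tabulate cell) (const true) k
  B-rooks k = count-placements (m * m) cell (const true) k _ λ p → mk⇔
    (λ (size , safe) → size , (λ _ _ → refl) ,
      λ s t s∈p t∈p s≢t → to (apart-⇔ s t) (safe s t s∈p t∈p s≢t))
    (λ (size , _ , apart) → size ,
      λ s t s∈p t∈p s≢t → from (apart-⇔ s t) (apart s t s∈p t∈p s≢t))

  -- The diagonals of a colour, sorted by length.

  -- The diagonals are indexed by (τ , c) with c < m, so that the length is
  -- c + bump τ: (true , c) is j − i = m − 1 − c, and (false , c) is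
  -- i − j = m − c, which is empty for c = 0.  Along a colour c grows by one
  -- and τ alternates; colour τ n ends with (τ , n − 1).
  bump : Bool → ℕ
  bump true  = 1
  bump false = 0

  height : Bool → ℕ → ℕ
  height τ c = bump τ + c

  -- The values of i - j + m on the two families: m - (m - 1 - c) = c + 1 and m + (m - c).
  diagonal : Bool → ℕ → ℕ
  diagonal true  c = suc c
  diagonal false c = m + (m ∸ c)

  -- A diagonal of length h, at distance m - h from the main one, meets the antidiagonals m - h, m -
  -- h + 2, ..., m + h - 2. These ranges are symmetric about m - 1, hence nested when their parities
  -- agree.
  rows : ℕ → List ℕ
  rows h = applyUpTo (λ x → x + x + (m ∸ h)) h

  column : Bool → ℕ → List Cell
  column τ c = map (diagonal τ c ,_) (rows (height τ c))

  colour : Bool → ℕ → List Cell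
  colour τ zero    = []
  colour τ (suc n) = colour (not τ) n ++ column τ n

  -- Follows the recursion of `colour`, so that telling which diagonals share a colour needs no
  -- arithmetic of parities.
  data Member : Bool → ℕ → Bool → ℕ → Set where
    last    : ∀ {τ n} → Member τ (suc n) τ n
    earlier : ∀ {τ n τ′ c} → Member (not τ) n τ′ c → Member τ (suc n) τ′ c

  Member-< : ∀ {τ n τ′ c} → Member τ n τ′ c → c < n
  Member-< last        = ≤-refl
  Member-< (earlier p) = m<n⇒m<1+n (Member-< p)

  Member-disjoint : ∀ {τ n τ′ c} → Member τ n τ′ c → ¬ Member (not τ) n τ′ c
  -- Splitting on τ rules out `last` on both sides, which would need τ to equal its negation.
  Member-disjoint {true}  last        (earlier q) = <-irrefl refl (Member-< q)
  Member-disjoint {false} last        (earlier q) = <-irrefl refl (Member-< q)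
  Member-disjoint {true}  (earlier p) last        = <-irrefl refl (Member-< p)
  Member-disjoint {false} (earlier p) last        = <-irrefl refl (Member-< p)
  Member-disjoint         (earlier p) (earlier q) = Member-disjoint p q

  Member-total : ∀ {c n} τ → c < n → Member false n τ c ⊎ Member true n τ c
  Member-total {c} {suc n} τ c<1+n with m≤n⇒m<n∨m≡n (s≤s⁻¹ c<1+n)
  -- Each further column exchanges the two colours, since `earlier` flips the type at the end.
  ... | inj₁ c<n = [ inj₂ ∘ earlier , inj₁ ∘ earlier ]′ (Member-total τ c<n)
  Member-total true  _ | inj₂ refl = inj₂ last
  Member-total false _ | inj₂ refl = inj₁ last

  colour⁺ : ∀ {τ n τ′ c x} → Member τ n τ′ c → x ∈ column τ′ c → x ∈ colour τ n
  colour⁺ {τ} {suc n} last        x∈ = ∈-++⁺ʳ (colour (not τ) n) x∈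
  colour⁺             (earlier p) x∈ = ∈-++⁺ˡ (colour⁺ p x∈)

  colour⁻ : ∀ {τ} n {x} → x ∈ colour τ n → ∃₂ λ τ′ c → Member τ n τ′ c × x ∈ column τ′ c
  colour⁻ {τ} (suc n) x∈ with ∈-++⁻ (colour (not τ) n) x∈
  ... | inj₂ x∈column = τ , n , last , x∈column
  ... | inj₁ x∈colour with τ′ , c , p , x∈column ← colour⁻ n x∈colour =
    τ′ , c , earlier p , x∈column

  column-diagonal : ∀ {τ c x} → x ∈ column τ c → proj₁ x ≡ diagonal τ c
  column-diagonal {τ} {c} x∈ with _ , _ , refl ← ∈-map⁻ (diagonal τ c ,_) x∈ = refl

  column-row : ∀ {τ c x} → x ∈ column τ c → proj₂ x ∈ rows (height τ c)
  column-row {τ} {c} x∈ with _ , s∈ , refl ← ∈-map⁻ (diagonal τ c ,_) x∈ = s∈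

  -- The two families do not mix: `suc c` is at most m, whereas `m + (m ∸ c)` exceeds m as c < m.
  diagonal-injective : ∀ {τ c τ′ c′} → c < m → c′ < m →
    diagonal τ c ≡ diagonal τ′ c′ → τ ≡ τ′ × c ≡ c′
  diagonal-injective {true}  {c} {true}  _   _    eq = refl , ℕ-suc-injective eq
  diagonal-injective {false} {c} {false} c<m c′<m eq =
    refl , ∸-cancelˡ-≡ (<⇒≤ c<m) (<⇒≤ c′<m) (+-cancelˡ-≡ m _ _ eq)
  diagonal-injective {true}  {c} {false} c<m c′<m eq =
    ⊥-elim (<⇒≢ (≤-<-trans c<m (m<m+n m (m<n⇒0<n∸m c′<m))) eq)
  diagonal-injective {false} {c} {true}  c<m c′<m eq =
    ⊥-elim (<⇒≢ (≤-<-trans c′<m (m<m+n m (m<n⇒0<n∸m c<m))) (sym eq))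

  rows-unique : ∀ h → Unique (rows h)
  rows-unique h = Unique.applyUpTo⁺₁ _ h λ i<j _ →
    <⇒≢ (+-monoˡ-< (m ∸ h) (+-mono-< i<j i<j))

  -- Two more cells add one antidiagonal at either end, so index x becomes x + 1.
  rows-grow₂ : ∀ {h s} → 2 + h ≤ m → s ∈ rows h → s ∈ rows (2 + h)
  rows-grow₂ {h} {s} 2+h≤m s∈ with x , x<h , s≡ ← ∈-applyUpTo⁻ _ s∈ =
    subst (_∈ rows (2 + h)) (sym (trans s≡ shifted)) (∈-applyUpTo⁺ (λ x → x + x + (m ∸ (2 + h))) (m<n⇒m<1+n (s≤s x<h)))
    where
    shifted : x + x + (m ∸ h) ≡ suc x + suc x + (m ∸ (2 + h))
    shifted = begin
      x + x + (m ∸ h)                   ≡⟨ cong (λ n → x + x + (n ∸ h)) (m+[n∸m]≡n 2+h≤m) ⟨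
      x + x + (2 + h + (m ∸ (2 + h)) ∸ h) ≡⟨ cong (λ n → x + x + (n ∸ h)) (solve 2 (λ h e → con 2 :+ h :+ e := h :+ (con 2 :+ e)) refl h (m ∸ (2 + h))) ⟩
      x + x + (h + (2 + (m ∸ (2 + h))) ∸ h) ≡⟨ cong (_+_ (x + x)) (m+n∸m≡n h _) ⟩
      x + x + (2 + (m ∸ (2 + h)))       ≡⟨ solve 2 (λ x e → x :+ x :+ (con 2 :+ e) := con 1 :+ x :+ (con 1 :+ x) :+ e) refl x (m ∸ (2 + h)) ⟩
      suc x + suc x + (m ∸ (2 + h))     ∎
      where open ≡-Reasoning

  rows-grow : ∀ τ {n s} → suc n < m → s ∈ rows (height (not τ) n) → s ∈ rows (height τ (suc n))
  -- The height rises by 2 into a raised column and is unchanged into one that is not.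
  rows-grow true  1+n<m s∈ = rows-grow₂ 1+n<m s∈
  rows-grow false 1+n<m s∈ = s∈

  -- The Ferrers property that `add-column` needs: each column has the rows of the one before it,
  -- hence of all earlier ones.
  colour-row : ∀ τ n {x} → n < m → x ∈ colour (not τ) n → proj₂ x ∈ rows (height τ n)
  colour-last-row : ∀ τ n {x} → n < m → x ∈ colour τ (suc n) → proj₂ x ∈ rows (height τ n)
  colour-row τ (suc n) 1+n<m x∈ =
    rows-grow τ 1+n<m (colour-last-row (not τ) n (<-trans (n<1+n n) 1+n<m) x∈)
  colour-last-row τ n n<m x∈ with ∈-++⁻ (colour (not τ) n) x∈
  ... | inj₁ x∈colour = colour-row τ n n<m x∈colour
  ... | inj₂ x∈column = column-row {τ} {n} x∈column

  -- Rook numbers of one colour.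

  half : Bool → ℕ → ℕ
  half true  = ⌈_/2⌉
  half false = ⌊_/2⌋

  -- `half τ n` counts the raised columns among n alternating ones that end with type τ. At n + 1 it
  -- computes to one more than the count for `not τ` at n if the new column is raised, and to that
  -- same count if not.
  bumpy-half : ∀ τ n k → bumpy (half τ (suc n)) (suc n) (suc k) ≡
    bumpy (half (not τ) n) n (suc k) + (height τ n ∸ k) * bumpy (half (not τ) n) n k
  bumpy-half true  n k = bumpy-raised k (⌊n/2⌋≤n n)
  bumpy-half false n k = bumpy-flat k (⌈n/2⌉≤n n)

  new-diagonal : ∀ τ n {x} → n < m → x ∈ colour (not τ) n → proj₁ x ≢ diagonal τ n
  new-diagonal τ n n<m x∈ eq with τ′ , c , p , x∈column ← colour⁻ n x∈ =
    <⇒≢ (Member-< p) (proj₂ (diagonal-injective {τ′} {c} {τ} {n} (<-trans (Member-< p) n<m) n<m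
      (trans (sym (column-diagonal {τ′} {c} x∈column)) eq)))

  -- Induction on the columns: `add-column` gives for the last diagonal the recursion that
  -- `bumpy-half` gives for `bumpy`.
  colour-rooks : ∀ τ n k → n ≤ m → rooks (colour τ n) (const true) k ≡ bumpy (half τ n) n k
  colour-rooks τ     n       zero    n≤m = refl
  colour-rooks true  zero    (suc k) n≤m = refl
  colour-rooks false zero    (suc k) n≤m = refl
  colour-rooks τ     (suc n) (suc k) n<m = begin
    rooks (colour (not τ) n ++ column τ n) (const true) (suc k)
      ≡⟨ add-column (colour (not τ) n) (diagonal τ n) (rows (height τ n)) (const true) k
           (rows-unique (height τ n)) (λ x∈ → new-diagonal τ n n<m x∈ , colour-row τ n n<m x∈) (λ _ _ → refl) ⟩
    rooks (colour (not τ) n) (const true) (suc k) +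
    (count (const true) (rows (height τ n)) ∸ k) * rooks (colour (not τ) n) (const true) k
      ≡⟨ cong₂ _+_ (colour-rooks (not τ) n (suc k) (<⇒≤ n<m)) (cong₂ (λ h r → (h ∸ k) * r)
           (trans (count-const-true (rows (height τ n))) (length-applyUpTo _ (height τ n)))
           (colour-rooks (not τ) n k (<⇒≤ n<m))) ⟩
    bumpy (half (not τ) n) n (suc k) + (height τ n ∸ k) * bumpy (half (not τ) n) n k
      ≡⟨ bumpy-half τ n k ⟨
    bumpy (half τ (suc n)) (suc n) (suc k) ∎
    where
    open ≡-Reasoning

  -- Independence of the two colours.

  colours-diagonal : ∀ {x y} → x ∈ colour false m → y ∈ colour true m → proj₁ x ≢ proj₁ y
  colours-diagonal x∈ y∈ eq
    with τ , c , p , x∈column ← colour⁻ m x∈ | τ′ , c′ , q , y∈column ← colour⁻ m y∈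
    with refl , refl ← diagonal-injective {τ} {c} {τ′} {c′} (Member-< p) (Member-< q)
      (trans (sym (column-diagonal {τ} {c} x∈column)) (trans eq (column-diagonal {τ′} {c′} y∈column))) =
    Member-disjoint p q

  -- The rows of the last column include all others and have one parity: even for `true`, odd for
  -- `false`, so adding `bump τ` makes them odd. The equation allows a split on `n` while the module
  -- parameter m stays fixed.
  colour-parity : ∀ τ n {x} → n ≡ m → x ∈ colour τ n → ∃ λ y → proj₂ x + bump τ ≡ 1 + 2 * y
  colour-parity τ (suc n) 1+n≡m x∈
    with y , _ , s≡ ← ∈-applyUpTo⁻ _ (colour-last-row τ n (≤-reflexive 1+n≡m) x∈) =
    y , trans (cong (_+ bump τ) s≡) (parity τ)
    where
    parity : ∀ τ → y + y + (m ∸ height τ n) + bump τ ≡ 1 + 2 * y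
    parity true  rewrite sym 1+n≡m | n∸n≡0 n =
      solve 1 (λ y → y :+ y :+ con 0 :+ con 1 := con 1 :+ con 2 :* y) refl y
    parity false rewrite sym 1+n≡m | m+n∸n≡m 1 n =
      solve 1 (λ y → y :+ y :+ con 1 :+ con 0 := con 1 :+ con 2 :* y) refl y

  colours-row : ∀ {x y} → x ∈ colour false m → y ∈ colour true m → proj₂ x ≢ proj₂ y
  colours-row {x} {y} x∈ y∈ eq
    with u , odd ← colour-parity false m refl x∈ | v , even ← colour-parity true m refl y∈ =
    even≢odd v u (ℕ-suc-injective (begin
      1 + 2 * v           ≡⟨ even ⟨
      proj₂ y + 1         ≡⟨ cong (_+ 1) eq ⟨
      proj₂ x + 1         ≡⟨ cong (_+ 1) (+-identityʳ (proj₂ x)) ⟨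
      proj₂ x + 0 + 1     ≡⟨ cong (_+ 1) odd ⟩
      1 + 2 * u + 1       ≡⟨ +-comm (1 + 2 * u) 1 ⟩
      2 + 2 * u           ∎))
    where open ≡-Reasoning

  -- The squares as the cells of the two colours.

  column⁺ : ∀ τ c {x} → x < height τ c →
    (diagonal τ c , x + x + (m ∸ height τ c)) ∈ column τ c
  column⁺ τ c x<h = ∈-map⁺ (diagonal τ c ,_) (∈-applyUpTo⁺ (λ x → x + x + (m ∸ height τ c)) x<h)

  column⁻ : ∀ τ c {p} → p ∈ column τ c →
    ∃ λ x → x < height τ c × p ≡ (diagonal τ c , x + x + (m ∸ height τ c))
  column⁻ τ c p∈ with s , s∈ , refl ← ∈-map⁻ (diagonal τ c ,_) p∈
    with x , x<h , refl ← ∈-applyUpTo⁻ _ s∈ = x , x<h , refl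

  rotate-above : ∀ i e → i + e < m → rotate i (i + e) ≡ (m ∸ e , i + i + e)
  rotate-above i e i+e<m = cong₂ _,_ (begin
    i + (m ∸ (i + e)) ≡⟨ cong (λ n → i + (m ∸ n)) (+-comm i e) ⟩
    i + (m ∸ (e + i)) ≡⟨ cong (_+_ i) (∸-+-assoc m e i) ⟨
    i + (m ∸ e ∸ i)   ≡⟨ m+[n∸m]≡n (m+n≤o⇒m≤o∸n i (<⇒≤ i+e<m)) ⟩
    m ∸ e             ∎) (sym (+-assoc i i e))
    where open ≡-Reasoning

  rotate-below : ∀ j e → j < m → rotate (j + e) j ≡ (m + e , j + j + e)
  rotate-below j e j<m = cong₂ _,_ (begin
    j + e + (m ∸ j)   ≡⟨ solve 3 (λ j e n → j :+ e :+ n := j :+ n :+ e) refl j e (m ∸ j) ⟩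
    j + (m ∸ j) + e   ≡⟨ cong (_+ e) (m+[n∸m]≡n (<⇒≤ j<m)) ⟩
    m + e             ∎) (solve 2 (λ j e → j :+ e :+ j := j :+ j :+ e) refl j e)
    where open ≡-Reasoning

  suc[m∸suc] : ∀ {e} → e < m → suc (m ∸ suc e) ≡ m ∸ e
  suc[m∸suc] e<m = sym (+-∸-assoc 1 e<m)

  rotate∈column : ∀ i j → i < m → j < m → ∃₂ λ τ c → c < m × rotate i j ∈ column τ c
  rotate∈column i j i<m j<m with i ≤? j
  ... | yes i≤j with e , refl ← m≤n⇒∃[o]m+o≡n i≤j =
    -- With e = j - i, the equation j - i = m - 1 - c gives c; the position on the diagonal is i.
    true , m ∸ suc e , subst (_≤ m) (sym c≡) (m∸n≤m m e) ,
    subst (_∈ column true (m ∸ suc e)) (sym (trans (rotate-above i e j<m) (cong₂ _,_ (sym c≡)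
        (cong (_+_ (i + i)) (sym (trans (cong (m ∸_) c≡) (m∸[m∸n]≡n (<⇒≤ e<m))))))))
      (column⁺ true (m ∸ suc e) (subst (i <_) (sym c≡) (m+n≤o⇒m≤o∸n (suc i) j<m)))
    where
    e<m : e < m
    e<m = ≤-<-trans (m≤n+m e i) j<m
    c≡ = suc[m∸suc] e<m
  ... | no i≰j with e , refl ← m≤n⇒∃[o]m+o≡n (≰⇒> i≰j) =
    -- Now i = j + 1 + e, so i - j = m - c gives the same formula for c; the position is j.
    false , m ∸ suc e , subst (_≤ m) (sym (suc[m∸suc] e<m)) (m∸n≤m m e) ,
    subst (_∈ column false (m ∸ suc e))
      (trans (cong (λ n → m + n , j + j + n) (m∸[m∸n]≡n e<m))
        (sym (trans (cong (λ i → rotate i j) (sym (+-suc j e))) (rotate-below j (suc e) j<m))))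
      (column⁺ false (m ∸ suc e) (m+n≤o⇒m≤o∸n (suc j) (subst (_< m) (sym (+-suc j e)) i<m)))
    where
    e<m : e < m
    e<m = ≤-<-trans (m≤n+m e (suc j)) i<m

  column-rotate : ∀ τ {c x} → c < m → x ∈ column τ c → ∃₂ λ i j → i < m × j < m × x ≡ rotate i j
  column-rotate true {c} c<m x∈ with x , x≤c , refl ← column⁻ true c x∈ =
    x , x + (m ∸ suc c) , <-≤-trans x≤c c<m , j<m ,
    sym (trans (rotate-above x _ j<m) (cong (_, x + x + (m ∸ suc c)) (m∸[m∸n]≡n c<m)))
    where
    j<m : x + (m ∸ suc c) < m
    j<m = <-≤-trans (+-monoˡ-< (m ∸ suc c) x≤c) (≤-reflexive (m+[n∸m]≡n c<m))
  column-rotate false {c} c<m x∈ with x , x<c , refl ← column⁻ false c x∈ =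
    x + (m ∸ c) , x , <-≤-trans (+-monoˡ-< (m ∸ c) x<c) (≤-reflexive (m+[n∸m]≡n (<⇒≤ c<m))) ,
    <-trans x<c c<m , sym (rotate-below x _ (<-trans x<c c<m))

  -- The two coordinates add up to 2i + m, which determines i; the second one then determines j.
  rotate-injective : ∀ {i j i′ j′} → j < m → j′ < m → rotate i j ≡ rotate i′ j′ → i ≡ i′ × j ≡ j′
  rotate-injective {i} {j} {i′} {j′} j<m j′<m eq = i≡i′ ,
    +-cancelˡ-≡ i′ j j′ (subst (λ n → n + j ≡ i′ + j′) i≡i′ (cong proj₂ eq))
    where
    total : ∀ i {j} → j < m → i + (m ∸ j) + (i + j) ≡ 2 * i + m
    total i {j} j<m = trans
      (solve 3 (λ i n j → i :+ n :+ (i :+ j) := con 2 :* i :+ (n :+ j)) refl i (m ∸ j) j)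
      (cong (_+_ (2 * i)) (m∸n+n≡m (<⇒≤ j<m)))
    i≡i′ : i ≡ i′
    i≡i′ = *-cancelˡ-≡ i i′ 2 (+-cancelʳ-≡ m (2 * i) (2 * i′) (trans (sym (total i j<m))
      (trans (cong (λ (d , s) → d + s) eq) (total i′ j′<m))))

  cell-injective : ∀ {s t} → cell s ≡ cell t → s ≡ t
  cell-injective {s} {t} eq with i≡ , j≡ ← rotate-injective
      (toℕ<n (proj₂ (remQuot {m} m s))) (toℕ<n (proj₂ (remQuot {m} m t))) eq = begin
    s                                   ≡⟨ combine-remQuot {m} m s ⟨
    combine (proj₁ (remQuot {m} m s)) (proj₂ (remQuot {m} m s))
      ≡⟨ cong₂ combine (toℕ-injective i≡) (toℕ-injective j≡) ⟩
    combine (proj₁ (remQuot {m} m t)) (proj₂ (remQuot {m} m t)) ≡⟨ combine-remQuot {m} m t ⟩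
    t                                   ∎
    where open ≡-Reasoning

  rotate∈cells : ∀ {i j} → i < m → j < m → rotate i j ∈ tabulate cell
  rotate∈cells {i} {j} i<m j<m = subst (_∈ tabulate cell) (begin
    cell (combine (fromℕ< i<m) (fromℕ< j<m))
      ≡⟨ cong (λ (i , j) → rotate (toℕ i) (toℕ j)) (remQuot-combine (fromℕ< i<m) (fromℕ< j<m)) ⟩
    rotate (toℕ (fromℕ< i<m)) (toℕ (fromℕ< j<m))
      ≡⟨ cong₂ rotate (toℕ-fromℕ< i<m) (toℕ-fromℕ< j<m) ⟩
    rotate i j ∎) (∈-tabulate⁺ (combine (fromℕ< i<m) (fromℕ< j<m)))
    where open ≡-Reasoning

  colour-unique : ∀ τ n → n ≤ m → Unique (colour τ n)
  colour-unique τ zero    _   = []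
  colour-unique τ (suc n) n<m = Unique.++⁺ (colour-unique (not τ) n (<⇒≤ n<m))
    (Unique.map⁺ (cong proj₂) (rows-unique (height τ n)))
    λ (x∈ , x∈column) → new-diagonal τ n n<m x∈ (column-diagonal {τ} {n} x∈column)

  -- Neither list repeats an entry, so it suffices that they have the same elements.
  cells-↭ : tabulate cell ↭ colour false m ++ colour true m
  cells-↭ = ∼bag⇒↭ (unique∧set⇒bag (Unique.tabulate⁺ cell-injective)
    (Unique.++⁺ (colour-unique false m ≤-refl) (colour-unique true m ≤-refl)
      λ (x∈ , y∈) → colours-diagonal x∈ y∈ refl)
    (mk⇔ cell∈ ∈cells))
    where
    cell∈ : ∀ {x} → x ∈ tabulate cell → x ∈ colour false m ++ colour true m
    cell∈ x∈ with s , refl ← ∈-tabulate⁻ x∈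
      with τ , c , c<m , ∈column ← rotate∈column _ _
        (toℕ<n (proj₁ (remQuot {m} m s))) (toℕ<n (proj₂ (remQuot {m} m s))) =
      [ (λ p → ∈-++⁺ˡ (colour⁺ p ∈column)) , (λ p → ∈-++⁺ʳ (colour false m) (colour⁺ p ∈column)) ]′
        (Member-total τ c<m)
    in-colour : ∀ {τ x} → x ∈ colour τ m → x ∈ tabulate cell
    in-colour x∈ with τ , c , p , x∈column ← colour⁻ m x∈
      with i , j , i<m , j<m , refl ← column-rotate τ (Member-< p) x∈column = rotate∈cells i<m j<m
    ∈cells : ∀ {x} → x ∈ colour false m ++ colour true m → x ∈ tabulate cell
    ∈cells x∈ = [ in-colour , in-colour ]′ (∈-++⁻ (colour false m) x∈)

  -- Assembling the formula.

  B-bumpy : ∀ k → B m k ≡ ∑[ j ≤ k ] (bumpy ⌊ m /2⌋ m j * bumpy ⌈ m /2⌉ m (k ∸ j))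
  B-bumpy k = begin
    B m k                                                     ≡⟨ B-rooks k ⟩
    rooks (tabulate cell) (const true) k                      ≡⟨ rooks-↭ cells-↭ (const true) k ⟩
    rooks (colour false m ++ colour true m) (const true) k
      ≡⟨ rooks-++ (colour false m) (colour true m) (const true) k
           (λ x∈ y∈ → colours-diagonal x∈ y∈ , colours-row x∈ y∈) ⟩
    ∑[ j ≤ k ] (rooks (colour false m) (const true) j * rooks (colour true m) (const true) (k ∸ j))
      ≡⟨ ∑₀-cong k (λ j _ → cong₂ _*_ (colour-rooks false m j ≤-refl) (colour-rooks true m (k ∸ j) ≤-refl)) ⟩
    ∑[ j ≤ k ] (bumpy ⌊ m /2⌋ m j * bumpy ⌈ m /2⌉ m (k ∸ j)) ∎
    where open ≡-Reasoning

theorem2p3 : (m k : ℕ) →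
    B m k ≡ ∑[ j ≤ k ] ∑[ i ≤ j ] ((⌊ m /2⌋ C i) * stirling (+ m -ℤ + i) (+ m -ℤ + j) *
    (∑[ l ≤ k ∸ j ] ((⌈ m /2⌉ C l) * stirling (+ m -ℤ + l) ((+ m -ℤ + k) +ℤ + j))))
theorem2p3 m k = trans (Board.B-bumpy m k) (∑₀-cong k term)
  where
  open ≡-Reasoning
  column-index : ∀ {j} → j ≤ k → + m -ℤ + (k ∸ j) ≡ (+ m -ℤ + k) +ℤ + j
  column-index {j} j≤k = begin
    + m -ℤ + (k ∸ j)              ≡⟨ ℤ.m-n≡m⊖n m (k ∸ j) ⟩
    m ⊖ (k ∸ j)                   ≡⟨ ℤ.+-cancelˡ-⊖ j m (k ∸ j) ⟨
    (j + m) ⊖ (j + (k ∸ j))       ≡⟨ cong₂ _⊖_ (+-comm j m) (m+[n∸m]≡n j≤k) ⟩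
    (m + j) ⊖ k                   ≡⟨ ℤ.distribˡ-⊖-+-pos j m k ⟨
    (m ⊖ k) +ℤ + j                ≡⟨ cong (_+ℤ + j) (ℤ.m-n≡m⊖n m k) ⟨
    (+ m -ℤ + k) +ℤ + j           ∎
  term : ∀ j → j ≤ k → bumpy ⌊ m /2⌋ m j * bumpy ⌈ m /2⌉ m (k ∸ j) ≡
    ∑[ i ≤ j ] ((⌊ m /2⌋ C i) * stirling (+ m -ℤ + i) (+ m -ℤ + j) *
    (∑[ l ≤ k ∸ j ] ((⌈ m /2⌉ C l) * stirling (+ m -ℤ + l) ((+ m -ℤ + k) +ℤ + j))))
  term j j≤k = trans
    (cong₂ _*_ (bumpy-stirling j (⌊n/2⌋≤n m))
      (trans (bumpy-stirling (k ∸ j) (⌈n/2⌉≤n m))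
        (∑₀-cong (k ∸ j) λ l _ → cong (λ r → (⌈ m /2⌉ C l) * stirling (+ m -ℤ + l) r) (column-index j≤k))))
    -- The sum over l does not depend on i, so it is a common factor of the terms of the sum over i.
    (sym (∑₀-*ʳ j (λ i → (⌊ m /2⌋ C i) * stirling (+ m -ℤ + i) (+ m -ℤ + j)) _))
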